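{- Let $(t_j^i)_{0\le j\le i}$ be real numbers and let $h_{j,k}^i$ ($0\le k\le i$, $0\le j\le i-k$) be defined by $h_{j,0}^i=t_j^i$ and $h_{j,k}^i=h_{j,k-1}^{i-1}+h_{j,k-1}^{i}+h_{j+1,k-1}^{i}$ for $k\ge 1$. Suppose that $t^i_{j}=t^{i-1}_{j-1}+t^{i-1}_{j}$ whenever $i\ge 2$ and $1\leq j\leq i-1$. Then for any $i,j,k$ with $0\leq k+2 \leq i$ and $1\leq j \leq i-1-k$, $$h^i_{j,k}=h^{i-1}_{j-1,k}+h^{i-1}_{j,k}.$$ -}

module Defs where

open import Data.Nat as ℕ using (ℕ; zero; suc; _∸_; _⊔_; s≤s; s≤s⁻¹)
import Data.Nat.Properties as ℕ
open import Data.Product using (∃-syntax; _,_)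
open import Data.Rational using (ℚ; 0ℚ; ½; _+_; _*_; _-_; _<_; ∣_∣)
open import Data.Rational.Properties
open import Data.Rational.Solver using (module +-*-Solver)
open import Relation.Binary.PropositionalEquality using (_≡_; refl; sym; trans; subst)

-- Real numbers are Cauchy sequences of rationals, and two of them are equal (_≈ℝ_) when
-- their difference is a null sequence. There are no quotient types here, so ℝ is used as a
-- setoid with equality _≈ℝ_.

IsCauchy : (ℕ → ℚ) → Set
IsCauchy x = ∀ ε → 0ℚ < ε → ∃[ N ] (∀ m n → N ℕ.≤ m → N ℕ.≤ n → ∣ x m - x n ∣ < ε)

record ℝ : Set where
  constructor mkℝ
  field
    seq    : ℕ → ℚ
    cauchy : IsCauchy seq

open ℝ public

infix 4 _≈ℝ_

_≈ℝ_ : ℝ → ℝ → Set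
x ≈ℝ y = ∀ ε → 0ℚ < ε → ∃[ N ] (∀ n → N ℕ.≤ n → ∣ seq x n - seq y n ∣ < ε)

0<½*ε : ∀ {ε} → 0ℚ < ε → 0ℚ < ½ * ε
0<½*ε {ε} 0<ε = subst (_< ½ * ε) (*-zeroʳ ½) (*-monoʳ-<-pos ½ 0<ε)

½*ε+½*ε≡ε : ∀ ε → ½ * ε + ½ * ε ≡ ε
½*ε+½*ε≡ε ε = trans (sym (*-distribʳ-+ ε ½ ½)) (*-identityˡ ε)

∣p∣<½ε∧∣q∣<½ε⇒∣p+q∣<ε : ∀ {p q ε} → ∣ p ∣ < ½ * ε → ∣ q ∣ < ½ * ε → ∣ p + q ∣ < ε
∣p∣<½ε∧∣q∣<½ε⇒∣p+q∣<ε {p} {q} {ε} p< q< =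
  subst (∣ p + q ∣ <_) (½*ε+½*ε≡ε ε) (≤-<-trans (∣p+q∣≤∣p∣+∣q∣ p q) (+-mono-< p< q<))

+-minus-interchange : ∀ a b c d → (a - c) + (b - d) ≡ (a + b) - (c + d)
+-minus-interchange = solve 4 (λ a b c d → (a :- c) :+ (b :- d) := (a :+ b) :- (c :+ d)) refl
  where open +-*-Solver

+-isCauchy : ∀ x y → IsCauchy x → IsCauchy y → IsCauchy (λ n → x n + y n)
+-isCauchy x y cx cy ε 0<ε with cx (½ * ε) (0<½*ε 0<ε) | cy (½ * ε) (0<½*ε 0<ε)
... | M , fx | N , fy = M ⊔ N , λ m n M⊔N≤m M⊔N≤n →
  subst (λ z → ∣ z ∣ < ε) (+-minus-interchange (x m) (y m) (x n) (y n))
    (∣p∣<½ε∧∣q∣<½ε⇒∣p+q∣<ε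
      (fx m n (ℕ.m⊔n≤o⇒m≤o M N M⊔N≤m) (ℕ.m⊔n≤o⇒m≤o M N M⊔N≤n))
      (fy m n (ℕ.m⊔n≤o⇒n≤o M N M⊔N≤m) (ℕ.m⊔n≤o⇒n≤o M N M⊔N≤n)))

infixl 6 _+ℝ_

_+ℝ_ : ℝ → ℝ → ℝ
seq    (x +ℝ y) n = seq x n + seq y n
cauchy (x +ℝ y)   = +-isCauchy (seq x) (seq y) (cauchy x) (cauchy y)

-- t i j is t_j^i; the range proof is irrelevant, so an entry depends only on (i , j).
TriangularArray : Set
TriangularArray = (i j : ℕ) → .(j ℕ.≤ i) → ℝ

j≤i-k⇒j≤1+i-k : ∀ {i j} k → j ℕ.≤ i ∸ k → j ℕ.≤ suc i ∸ k
j≤i-k⇒j≤1+i-k {i} k j≤ = ℕ.≤-trans j≤ (ℕ.∸-monoˡ-≤ k (ℕ.n≤1+n i))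

j≤i-k⇒1+j≤1+i-k : ∀ {i j k} → k ℕ.≤ i → j ℕ.≤ i ∸ k → suc j ℕ.≤ suc i ∸ k
j≤i-k⇒1+j≤1+i-k {j = j} k≤i j≤ = subst (suc j ℕ.≤_) (sym (ℕ.+-∸-assoc 1 k≤i)) (s≤s j≤)

-- h t i j k is h_{j,k}^i. For k ≥ 1 the bound k ≤ i forces i ≥ 1, hence the pattern suc i.
h : TriangularArray → (i j k : ℕ) → .(k ℕ.≤ i) → .(j ℕ.≤ i ∸ k) → ℝ
h t i       j zero    _   j≤i = t i j j≤i
h t (suc i) j (suc k) k<i j≤  =
     h t i       j       k (s≤s⁻¹ k<i) j≤
  +ℝ h t (suc i) j       k (ℕ.<⇒≤ k<i) (j≤i-k⇒j≤1+i-k k j≤)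
  +ℝ h t (suc i) (suc j) k (ℕ.<⇒≤ k<i) (j≤i-k⇒1+j≤1+i-k (s≤s⁻¹ k<i) j≤)

j≤i-1⇒j≤i : ∀ {i j} → j ℕ.≤ i ∸ 1 → j ℕ.≤ i
j≤i-1⇒j≤i {i} j≤ = ℕ.≤-trans j≤ (ℕ.m∸n≤m i 1)

j≤m⇒j-1≤m : ∀ {m j} → j ℕ.≤ m → j ∸ 1 ℕ.≤ m
j≤m⇒j-1≤m {j = j} j≤m = ℕ.≤-trans (ℕ.m∸n≤m j 1) j≤m

k+2≤i⇒k≤i : ∀ {i k} → k ℕ.+ 2 ℕ.≤ i → k ℕ.≤ i
k+2≤i⇒k≤i {k = k} k+2≤i = ℕ.≤-trans (ℕ.m≤m+n k 2) k+2≤i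

k+2≤i⇒k≤i-1 : ∀ {i k} → k ℕ.+ 2 ℕ.≤ i → k ℕ.≤ i ∸ 1
k+2≤i⇒k≤i-1 {k = k} k+2≤i =
  ℕ.∸-monoˡ-≤ 1 (ℕ.≤-trans (subst (suc k ℕ.≤_) (ℕ.+-comm 2 k) (ℕ.n≤1+n (suc k))) k+2≤i)

j≤i-1-k⇒j≤i-k : ∀ {i j} k → j ℕ.≤ i ∸ 1 ∸ k → j ℕ.≤ i ∸ k
j≤i-1-k⇒j≤i-k {i} k j≤ = ℕ.≤-trans j≤ (ℕ.∸-monoˡ-≤ k (ℕ.m∸n≤m i 1))

{-# OPTIONS --safe #-}
module Submission where

open import Defs
open import Data.Nat using (ℕ; _+_; _∸_; _≤_; zero; suc; s≤s; z≤n; s≤s⁻¹; _⊔_)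
open import Data.Nat.Properties using (m⊔n≤o⇒m≤o; m⊔n≤o⇒n≤o; m≤n⇒m≤1+n)
open import Data.Product using (_,_)
open import Data.Rational as ℚ using (½; ∣_∣)
open import Data.Rational.Solver using (module +-*-Solver)
open import Relation.Binary.PropositionalEquality using (_≡_; refl; subst)

-- Induction on `k`; the base case is the hypothesis on `t`. The recursion makes `h` at level
-- `k + 1` a sum of three entries at level `k`, with fixed shifts of the indices. The Pascal rule is
-- linear and invariant under these shifts, so by induction each of the three entries splits in two.
-- Regrouping the six terms by column, as in `+ℝ-cong-transpose`, gives the recursion for the two
-- entries on the right.

+ℝ-cong : ∀ {x x′ y y′} → x ≈ℝ x′ → y ≈ℝ y′ → x +ℝ y ≈ℝ x′ +ℝ y′
+ℝ-cong {x} {x′} {y} {y′} x≈x′ y≈y′ ε 0<ε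
  with x≈x′ (½ ℚ.* ε) (0<½*ε 0<ε) | y≈y′ (½ ℚ.* ε) (0<½*ε 0<ε)
... | M , fx | N , fy = M ⊔ N , λ n M⊔N≤n →
  subst (λ z → ∣ z ∣ ℚ.< ε) (+-minus-interchange (seq x n) (seq y n) (seq x′ n) (seq y′ n))
    (∣p∣<½ε∧∣q∣<½ε⇒∣p+q∣<ε
      (fx n (m⊔n≤o⇒m≤o M N M⊔N≤n))
      (fy n (m⊔n≤o⇒n≤o M N M⊔N≤n)))

-- Lets the regrouping be done exactly, term by term in `ℚ`, so that only `+ℝ-cong` has to split
-- `ε`.
≈ℝ-respʳ-≗ : ∀ {x y z} → (∀ n → seq y n ≡ seq z n) → x ≈ℝ y → x ≈ℝ z
≈ℝ-respʳ-≗ {x} y≗z x≈y ε 0<ε with x≈y ε 0<ε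
... | N , f = N , λ n N≤n → subst (λ q → ∣ seq x n ℚ.- q ∣ ℚ.< ε) (y≗z n) (f n N≤n)

+-transpose : ∀ a a′ b b′ c c′ →
  (a ℚ.+ a′) ℚ.+ (b ℚ.+ b′) ℚ.+ (c ℚ.+ c′) ≡ (a ℚ.+ b ℚ.+ c) ℚ.+ (a′ ℚ.+ b′ ℚ.+ c′)
+-transpose = solve 6 (λ a a′ b b′ c c′ →
  (a :+ a′) :+ (b :+ b′) :+ (c :+ c′) := (a :+ b :+ c) :+ (a′ :+ b′ :+ c′)) refl
  where open +-*-Solver

+ℝ-cong-transpose : ∀ {x y z a a′ b b′ c c′} →
  x ≈ℝ a +ℝ a′ → y ≈ℝ b +ℝ b′ → z ≈ℝ c +ℝ c′ →
  x +ℝ y +ℝ z ≈ℝ (a +ℝ b +ℝ c) +ℝ (a′ +ℝ b′ +ℝ c′)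
+ℝ-cong-transpose {x} {y} {z} {a} {a′} {b} {b′} {c} {c′} x≈ y≈ z≈ =
  ≈ℝ-respʳ-≗ {x +ℝ y +ℝ z} {(a +ℝ a′) +ℝ (b +ℝ b′) +ℝ (c +ℝ c′)}
    {(a +ℝ b +ℝ c) +ℝ (a′ +ℝ b′ +ℝ c′)}
    (λ n → +-transpose (seq a n) (seq a′ n) (seq b n) (seq b′ n) (seq c n) (seq c′ n))
    (+ℝ-cong {x +ℝ y} {(a +ℝ a′) +ℝ (b +ℝ b′)} {z} {c +ℝ c′}
      (+ℝ-cong {x} {a +ℝ a′} {y} {b +ℝ b′} x≈ y≈) z≈)

theorem4 : (t : TriangularArray) →
    ((i j : ℕ) → 2 ≤ i → 1 ≤ j → (j≤i-1 : j ≤ i ∸ 1) →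
    t i j (j≤i-1⇒j≤i j≤i-1)
    ≈ℝ t (i ∸ 1) (j ∸ 1) (j≤m⇒j-1≤m j≤i-1) +ℝ t (i ∸ 1) j j≤i-1) →
    (i j k : ℕ) → (k+2≤i : k + 2 ≤ i) → 1 ≤ j → (j≤i-1-k : j ≤ i ∸ 1 ∸ k) →
    h t i j k (k+2≤i⇒k≤i k+2≤i) (j≤i-1-k⇒j≤i-k k j≤i-1-k)
    ≈ℝ h t (i ∸ 1) (j ∸ 1) k (k+2≤i⇒k≤i-1 k+2≤i) (j≤m⇒j-1≤m j≤i-1-k)
    +ℝ h t (i ∸ 1) j k (k+2≤i⇒k≤i-1 k+2≤i) j≤i-1-k
theorem4 t pascal i j zero 2≤i 1≤j j≤ = pascal i j 2≤i 1≤j j≤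
theorem4 t pascal (suc (suc i)) (suc j) (suc k) k+3≤i _ j≤ =
  +ℝ-cong-transpose
    -- `_≈ℝ_` unfolds to a statement about `seq`, from which the reals cannot be inferred, so they
    -- are given. Their bounds are irrelevant, so it does not matter how they were derived.
    {h t (suc i) (suc j) k _ _} {h t (suc (suc i)) (suc j) k _ _}
    {h t (suc (suc i)) (suc (suc j)) k _ _}
    {h t i j k _ _} {h t i (suc j) k _ _}
    {h t (suc i) j k _ _} {h t (suc i) (suc j) k _ _}
    {h t (suc i) (suc j) k _ _} {h t (suc i) (suc (suc j)) k _ _}
    (theorem4 t pascal (suc i) (suc j) k k+2≤1+i (s≤s z≤n) j≤)
    (theorem4 t pascal (suc (suc i)) (suc j) k (m≤n⇒m≤1+n k+2≤1+i) (s≤s z≤n)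
      (j≤i-k⇒j≤1+i-k k j≤))
    -- Raising the column by one stays in range because `k ≤ i` gives `suc i ∸ k ≡ suc (i ∸ k)`.
    (theorem4 t pascal (suc (suc i)) (suc (suc j)) k (m≤n⇒m≤1+n k+2≤1+i) (s≤s z≤n)
      (j≤i-k⇒1+j≤1+i-k (k+2≤i⇒k≤i-1 k+2≤1+i) j≤))
  where
  k+2≤1+i : k + 2 ≤ suc i
  k+2≤1+i = s≤s⁻¹ k+3≤i
-- Row 1 is too short for `k ≥ 1`; splitting `k` again lets `k + 2` reduce to a successor, which
-- exposes the contradiction.
theorem4 t pascal (suc zero) j (suc zero) (s≤s ()) _ _
theorem4 t pascal (suc zero) j (suc (suc k)) (s≤s ()) _ _
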